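{- For $m\ge 0$ let $r(m)$ be the number of $\approx$-equivalence classes of two-layer comparator networks on $m$ channels whose first layer is $F_m=\{(2i-1,2i):1\le i\le\lfloor m/2\rfloor\}$ (so $r(0)=1$, the empty network). Then for every $n\ge 2$, the number of $\approx$-equivalence classes of redundant two-layer comparator networks on $n$ channels with first layer $F_n$ equals $r(n-2)$.
   Context: A comparator network on $n$ channels is a sequence of layers; each layer is a set of comparators $(i,j)$, $1\le i<j\le n$, with each channel in at most one comparator of the layer. On an input, comparator $(i,j)$ places the minimum of the values on channels $i,j$ on channel $i$ and the maximum on channel $j$; untouched channels keep their values. For a network $C$, $\mathrm{outputs}(C)=\{C(\vec x):\vec x\in\{0,1\}^n\}$. For a permutation $\pi$ of $\{1,\ldots,n\}$ and $\vec x\in\{0,1\}^n$, $\pi(\vec x)$ is the vector $\vec y$ with $y_{\pi(i)}=x_i$, and $\pi$ acts elementwise on sets of vectors. A comparator network $C$ is redundant if there is a network $C'$ obtained from $C$ by removing one comparator such that $\mathrm{outputs}(C')=\pi(\mathrm{outputs}(C))$ for some permutation $\pi$. Graph representation: $\mathcal G(C)$ has one vertex per comparator; for a comparator $u$ in layer $k$ and a comparator $v$ in a later layer, there is an edge labeled $1$ (resp. $2$) from $u$ to $v$ if the smaller (resp. larger) channel of $u$ is used by $v$ and by no comparator in a layer strictly between. $C_1\approx C_2$ means $\mathcal G(C_1)$ and $\mathcal G(C_2)$ are isomorphic as edge-labeled directed graphs. -}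

module Defs where

open import Data.Nat using (ℕ; zero; suc; s≤s)
open import Data.Fin using (Fin; toℕ) renaming (zero to fz; suc to fs; _<_ to _<ᶠ_)
open import Data.Fin.Permutation using (Permutation′; _⟨$⟩ˡ_)
open import Data.Bool using (Bool; _∧_; _∨_)
open import Data.Vec using (Vec; lookup; tabulate; _[_]≔_)
open import Data.List using (List; []; _∷_; length; foldl; map)
import Data.List as List
open import Data.List.Relation.Unary.AllPairs using (AllPairs)
open import Data.Product using (Σ; _×_; _,_; ∃)
open import Data.Sum using (_⊎_)
open import Relation.Binary.PropositionalEquality using (_≡_; _≢_)
open import Relation.Nullary using (¬_)
open import Function.Bundles using (_⇔_; _↔_; Inverse)
import Data.Nat as ℕ

record Comparator (n : ℕ) : Set where
  constructor comp
  field
    lo    : Fin n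
    hi    : Fin n
    lo<hi : lo <ᶠ hi
open Comparator public

Layer : ℕ → Set
Layer n = List (Comparator n)

Network : ℕ → Set
Network n = List (Layer n)

UsedBy : ∀ {n} → Fin n → Comparator n → Set
UsedBy c d = (c ≡ lo d) ⊎ (c ≡ hi d)

Disjoint : ∀ {n} → Comparator n → Comparator n → Set
Disjoint c d = ¬ UsedBy (lo c) d × ¬ UsedBy (hi c) d

ValidLayer : ∀ {n} → Layer n → Set
ValidLayer L = AllPairs Disjoint L

applyComparator : ∀ {n} → Vec Bool n → Comparator n → Vec Bool n
applyComparator x c =
  (x [ lo c ]≔ (lookup x (lo c) ∧ lookup x (hi c))) [ hi c ]≔ (lookup x (lo c) ∨ lookup x (hi c))

applyLayer : ∀ {n} → Vec Bool n → Layer n → Vec Bool n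
applyLayer = foldl applyComparator

run : ∀ {n} → Network n → Vec Bool n → Vec Bool n
run C x = foldl applyLayer x C

-- π(x) = y with y_{π(i)} = x_i, i.e. y_c = x_{π⁻¹(c)}
permute : ∀ {n} → Permutation′ n → Vec Bool n → Vec Bool n
permute π x = tabulate (λ c → lookup x (π ⟨$⟩ˡ c))

InOutputs : ∀ {n} → Network n → Vec Bool n → Set
InOutputs C y = ∃ λ x → run C x ≡ y

InPermOutputs : ∀ {n} → Permutation′ n → Network n → Vec Bool n → Set
InPermOutputs π C y = ∃ λ x → InOutputs C x × permute π x ≡ y

data DelOne {A : Set} : List A → List A → Set where
  here  : ∀ {x xs} → DelOne (x ∷ xs) xs
  there : ∀ {x xs ys} → DelOne xs ys → DelOne (x ∷ xs) (x ∷ ys)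

data RemoveOne {n : ℕ} : Network n → Network n → Set where
  here  : ∀ {L L' Ls} → DelOne L L' → RemoveOne (L ∷ Ls) (L' ∷ Ls)
  there : ∀ {L Ls Ls'} → RemoveOne Ls Ls' → RemoveOne (L ∷ Ls) (L ∷ Ls')

Redundant : ∀ {n} → Network n → Set
Redundant {n} C =
  Σ (Network n) λ C' → RemoveOne C C' ×
  Σ (Permutation′ n) λ π → ∀ y → InOutputs C' y ⇔ InPermOutputs π C y

Vertex : ∀ {n} → Network n → Set
Vertex C = Σ (Fin (length C)) λ k → Fin (length (List.lookup C k))

compAt : ∀ {n} (C : Network n) → Vertex C → Comparator n
compAt C (k , a) = List.lookup (List.lookup C k) a

data Label : Set where
  one two : Label

labChan : ∀ {n} → Label → Comparator n → Fin n
labChan one c = lo c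
labChan two c = hi c

Edge : ∀ {n} (C : Network n) → Label → Vertex C → Vertex C → Set
Edge C ℓ (k , a) (l , b) =
  toℕ k ℕ.< toℕ l ×
  UsedBy (labChan ℓ (compAt C (k , a))) (compAt C (l , b)) ×
  (∀ (m : Fin (length C)) → toℕ k ℕ.< toℕ m → toℕ m ℕ.< toℕ l →
     ∀ (c : Fin (length (List.lookup C m))) →
     ¬ UsedBy (labChan ℓ (compAt C (k , a))) (compAt C (m , c)))

_≈_ : ∀ {n} → Network n → Network n → Set
C₁ ≈ C₂ = Σ (Vertex C₁ ↔ Vertex C₂) λ f →
  ∀ ℓ u v → Edge C₁ ℓ u v ⇔ Edge C₂ ℓ (Inverse.to f u) (Inverse.to f v)

-- The first layer F_n = {(2i-1,2i)} (1-indexed), i.e. {(2i,2i+1)} 0-indexed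

shift2 : ∀ {n} → Comparator n → Comparator (suc (suc n))
shift2 (comp i j p) = comp (fs (fs i)) (fs (fs j)) (s≤s (s≤s p))

firstLayer : (n : ℕ) → Layer n
firstLayer zero = []
firstLayer (suc zero) = []
firstLayer (suc (suc n)) = comp fz (fs fz) (s≤s ℕ.z≤n) ∷ map shift2 (firstLayer n)

-- two-layer networks with first layer F_n, given by their second layer
TwoLayer : ℕ → Set
TwoLayer n = Σ (Layer n) ValidLayer

net : ∀ {n} → TwoLayer n → Network n
net {n} (L , _) = firstLayer n ∷ L ∷ []

RedundantTwoLayer : ℕ → Set
RedundantTwoLayer n = Σ (TwoLayer n) λ N → Redundant (net N)

-- "R has exactly k equivalence classes on A": a surjection A → Fin k
-- whose fibres are exactly the R-classes.

NumClasses : (A : Set) → (A → A → Set) → ℕ → Set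
NumClasses A R k = Σ (A → Fin k) λ f →
  (∀ i → ∃ λ a → f a ≡ i) × (∀ a b → (f a ≡ f b) ⇔ R a b)

{-# OPTIONS --safe #-}
module Submission where

-- A two-layer network is redundant exactly when some first-layer comparator is repeated in the
-- second layer. If it has one, the second copy does nothing. Otherwise, removing a comparator
-- strictly enlarges the outputs: a first-layer removal adds an output, and a second-layer
-- removal undoes the identification of two outputs.
-- A repeated comparator is an isolated double edge of the graph; leaving out its two channels
-- gives a network on n - 2 channels, and since an isolated double edge can be cancelled from an
-- isomorphism, this is a bijection on isomorphism classes.

open import Defs
open import Data.Bool using (Bool; true; false; not; _∧_; _∨_)
import Data.Bool.Properties as Boolₚ
open import Data.Bool.Properties using (∧-comm; ∨-comm)
open import Data.Empty using (⊥; ⊥-elim)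
open import Data.Fin using (Fin; toℕ; funToFin; finToFun) renaming (zero to fz; suc to fs; _<_ to _<ᶠ_)
import Data.Fin.Permutation as Perm
open import Data.Fin.Permutation using (Permutation′)
import Data.Fin.Properties as Finₚ
open import Data.Fin.Properties using (_≟_; pigeonhole; 2↔Bool; finToFun-funToFin; +↔⊎; injective⇒≤)
import Data.List as List
open import Data.List using (List; []; _∷_; length; map; allFin; cartesianProduct; cartesianProductWith)
open import Data.List.Membership.Propositional using (_∈_; find; lose)
open import Data.List.Membership.Propositional.Properties using (∈-AllPairs₂; ∈-map⁻; ∈-lookup; ∈-allFin; ∈-cartesianProduct⁺; ∈-cartesianProductWith⁺)
import Data.List.Relation.Unary.All as All
open import Data.List.Relation.Unary.All using (All; []; _∷_)
import Data.List.Relation.Unary.All.Properties as Allₚ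
open import Data.List.Relation.Unary.All.Properties using (¬Any⇒All¬)
open import Data.List.Relation.Unary.AllPairs using (AllPairs; []; _∷_; allPairs?)
import Data.List.Relation.Unary.Any as Any
open import Data.List.Relation.Unary.Any using (Any; here; there; any?)
import Data.List.Relation.Unary.Any.Properties as Anyₚ
import Data.Nat as ℕ
open import Data.Nat using (ℕ; zero; suc; _≤_; _∸_; z≤n; s≤s; _^_)
import Data.Nat.Properties as ℕₚ
open import Data.Product using (Σ; _×_; _,_; ∃; proj₁; proj₂; ∃₂)
import Data.Sum as Sum
open import Data.Sum using (_⊎_; inj₁; inj₂; [_,_]′; map₁; map₂)
open import Data.Sum.Function.Propositional using (_⊎-↔_)
open import Data.Sum.Properties using (inj₁-injective; inj₂-injective)
open import Data.Unit using (⊤; tt)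
open import Data.Vec using (Vec; lookup; tabulate; _[_]≔_; []; _∷_)
import Data.Vec.Properties as Vecₚ
open import Data.Vec.Properties using (lookup∘update; lookup∘update′; lookup∘tabulate; tabulate∘lookup; tabulate-cong)
open import Function using (_∘_; id)
open import Function.Bundles using (_⇔_; mk⇔; Equivalence; Inverse; _↔_; mk↔ₛ′)
open import Function.Construct.Composition using (_↔-∘_; _⇔-∘_)
open import Function.Construct.Identity using (↔-id; ⇔-id)
open import Function.Construct.Symmetry using (↔-sym; ⇔-sym)
open import Relation.Binary.Definitions using (tri<; tri≈; tri>)
open import Relation.Binary.PropositionalEquality
open import Relation.Nullary using (¬_; Dec; yes; no; does)
open import Relation.Nullary.Decidable using (_×-dec_; _⊎-dec_; dec-true; dec-false; decidable-stable; _→-dec_; ¬?; map′)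

-- Redundancy allows an arbitrary permutation `π`, so two different output sets are not yet a
-- contradiction, and no cardinality is computed to get one. Instead, outputs(C') = π(outputs(C))
-- yields a map from outputs(C') onto itself that stays onto when one vector is dropped from its
-- domain, which is impossible for a finite set. For a deleted second-layer comparator `c` the map
-- is `c` followed by `π`, and the dropped vector is one of the two that `c` identifies. For a
-- deleted first-layer comparator the map is `π`, and the dropped vector is the new output.
--
-- Cancelling a double edge is not mere restriction: the rest of the graph may contain further
-- isolated double edges, and an isomorphism may carry the added one to any of them. Vertices that
-- land in the added pair are therefore sent on by a second application of the isomorphism.
--
-- A number of classes is here a function into `Fin k`, so choosing representatives requires a
-- decision procedure for isomorphism and a finite list meeting every class. Both are needed only
-- for the smaller networks; the count is then transported.

private variable n : ℕ

-- The action of a valid layer on Boolean vectors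

lookup-injective : ∀ {A : Set} (x y : Vec A n) → (∀ i → lookup x i ≡ lookup y i) → x ≡ y
lookup-injective x y e = trans (sym (tabulate∘lookup x)) (trans (tabulate-cong e) (tabulate∘lookup y))

lo≢hi : (d : Comparator n) → lo d ≢ hi d
lo≢hi d e = Finₚ.<⇒≢ (lo<hi d) e

usedBy? : (c : Fin n) (d : Comparator n) → Dec (UsedBy c d)
usedBy? c d = (c ≟ lo d) ⊎-dec (c ≟ hi d)

Disjoint-used : ∀ (d e : Comparator n) {c} → Disjoint d e → UsedBy c d → ¬ UsedBy c e
Disjoint-used d e (p , q) (inj₁ refl) = p
Disjoint-used d e (p , q) (inj₂ refl) = q

Disjoint-sym : ∀ (d e : Comparator n) → Disjoint d e → Disjoint e d
Disjoint-sym d e dj = (λ u → Disjoint-used d e dj u (inj₁ refl)) , (λ u → Disjoint-used d e dj u (inj₂ refl))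

valid-unique : ∀ {L : Layer n} {d e c} → ValidLayer L → d ∈ L → e ∈ L →
               UsedBy c d → UsedBy c e → d ≡ e
valid-unique {d = d} {e} v d∈ e∈ u w with ∈-AllPairs₂ v d∈ e∈
... | inj₁ eq = eq
... | inj₂ (inj₁ dj) = ⊥-elim (Disjoint-used d e dj u w)
... | inj₂ (inj₂ dj) = ⊥-elim (Disjoint-used e d dj w u)

Idle : Layer n → Fin n → Set
Idle L c = ∀ {d} → d ∈ L → ¬ UsedBy c d

module _ (x : Vec Bool n) (d : Comparator n) where
  apply-lo : lookup (applyComparator x d) (lo d) ≡ lookup x (lo d) ∧ lookup x (hi d)
  apply-lo = trans (lookup∘update′ (lo≢hi d) (x [ lo d ]≔ _) _) (lookup∘update (lo d) x _)

  apply-hi : lookup (applyComparator x d) (hi d) ≡ lookup x (lo d) ∨ lookup x (hi d)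
  apply-hi = lookup∘update (hi d) (x [ lo d ]≔ _) _

  apply-other : ∀ {c} → ¬ UsedBy c d → lookup (applyComparator x d) c ≡ lookup x c
  apply-other {c} nu = trans (lookup∘update′ (nu ∘ inj₂) (x [ lo d ]≔ _) _) (lookup∘update′ (nu ∘ inj₁) x _)

layer-idle : ∀ (x : Vec Bool n) L {c} → Idle L c → lookup (applyLayer x L) c ≡ lookup x c
layer-idle x [] i = refl
layer-idle x (d ∷ L) i = trans (layer-idle (applyComparator x d) L (i ∘ there)) (apply-other x d (i (here refl)))

idle-tail : ∀ {d : Comparator n} {L c} → All (Disjoint d) L → UsedBy c d → Idle L c
idle-tail {d = d} a u {e} e∈ = Disjoint-used d e (All.lookup a e∈) u

idle-head : ∀ {d e : Comparator n} {L c} → All (Disjoint d) L → e ∈ L → UsedBy c e → ¬ UsedBy c d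
idle-head {d = d} {e} a e∈ u w = Disjoint-used d e (All.lookup a e∈) w u

layer-lo : ∀ (x : Vec Bool n) {L d} → ValidLayer L → d ∈ L →
           lookup (applyLayer x L) (lo d) ≡ lookup x (lo d) ∧ lookup x (hi d)
layer-lo x {d ∷ L} (a ∷ v) (here refl) =
  trans (layer-idle _ L (idle-tail {d = d} a (inj₁ refl))) (apply-lo x d)
layer-lo x {e ∷ L} {d} (a ∷ v) (there d∈) = trans (layer-lo (applyComparator x e) v d∈)
  (cong₂ _∧_ (apply-other x e (idle-head {d = e} {d} a d∈ (inj₁ refl))) (apply-other x e (idle-head {d = e} {d} a d∈ (inj₂ refl))))

layer-hi : ∀ (x : Vec Bool n) {L d} → ValidLayer L → d ∈ L →
           lookup (applyLayer x L) (hi d) ≡ lookup x (lo d) ∨ lookup x (hi d)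
layer-hi x {d ∷ L} (a ∷ v) (here refl) =
  trans (layer-idle _ L (idle-tail {d = d} a (inj₂ refl))) (apply-hi x d)
layer-hi x {e ∷ L} {d} (a ∷ v) (there d∈) = trans (layer-hi (applyComparator x e) v d∈)
  (cong₂ _∨_ (apply-other x e (idle-head {d = e} {d} a d∈ (inj₁ refl))) (apply-other x e (idle-head {d = e} {d} a d∈ (inj₂ refl))))

SortedAt : Vec Bool n → Comparator n → Set
SortedAt x d = lookup x (lo d) ≡ true → lookup x (hi d) ≡ true

∧-sorted : ∀ a b → (a ≡ true → b ≡ true) → a ∧ b ≡ a
∧-sorted false b f = refl
∧-sorted true b f = f refl

∨-sorted : ∀ a b → (a ≡ true → b ≡ true) → a ∨ b ≡ b
∨-sorted false b f = refl
∨-sorted true b f = sym (f refl)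

apply-sorted : (x : Vec Bool n) (d : Comparator n) → SortedAt x d → applyComparator x d ≡ x
apply-sorted x d s = lookup-injective _ _ go
  where
  go : ∀ c → lookup (applyComparator x d) c ≡ lookup x c
  go c with usedBy? c d
  ... | yes (inj₁ refl) = trans (apply-lo x d) (∧-sorted _ _ s)
  ... | yes (inj₂ refl) = trans (apply-hi x d) (∨-sorted (lookup x (lo d)) _ s)
  ... | no nu = apply-other x d nu

layer-sorted : (x : Vec Bool n) (L : Layer n) → (∀ {d} → d ∈ L → SortedAt x d) → applyLayer x L ≡ x
layer-sorted x [] s = refl
layer-sorted x (d ∷ L) s rewrite apply-sorted x d (s (here refl)) = layer-sorted x L (s ∘ there)

sorted-∧∨ : ∀ a b → a ∧ b ≡ true → a ∨ b ≡ true
sorted-∧∨ true b e = refl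

sorted-layer : (x : Vec Bool n) {L : Layer n} → ValidLayer L → ∀ {d} → d ∈ L → SortedAt (applyLayer x L) d
sorted-layer x v {d} d∈ e = trans (layer-hi x v d∈) (sorted-∧∨ (lookup x (lo d)) _ (trans (sym (layer-lo x v d∈)) e))

-- The partner relation of a layer. Idle channels are their own partners, which makes the relation
-- total, symmetric and single-valued on a valid layer.
data Matched (L : Layer n) (a c : Fin n) : Set where
  idle : Idle L a → c ≡ a → Matched L a c
  low  : ∀ {d} → d ∈ L → a ≡ lo d → c ≡ hi d → Matched L a c
  high : ∀ {d} → d ∈ L → a ≡ hi d → c ≡ lo d → Matched L a c

match : (L : Layer n) (a : Fin n) → ∃ (Matched L a)
match L a with any? (usedBy? a) L
... | no ¬u = a , idle (λ d∈ u → ¬u (lose d∈ u)) refl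
... | yes u with find u
... | d , d∈ , inj₁ e = hi d , low d∈ e refl
... | d , d∈ , inj₂ e = lo d , high d∈ e refl

∧∨-∧ : ∀ a b → (a ∧ b) ∧ (a ∨ b) ≡ a ∧ b
∧∨-∧ false b = refl
∧∨-∧ true false = refl
∧∨-∧ true true = refl

∧∨-∨ : ∀ a b → (a ∧ b) ∨ (a ∨ b) ≡ a ∨ b
∧∨-∨ false b = refl
∧∨-∨ true false = refl
∧∨-∨ true true = refl

-- A layer at most exchanges the values of two partners, so symmetric functions of these values
-- survive. This and `matched-∨` allow properties of an input to be read off its image.
matched-∧ : ∀ (x : Vec Bool n) {L a c} → ValidLayer L → Matched L a c →
  lookup (applyLayer x L) a ∧ lookup (applyLayer x L) c ≡ lookup x a ∧ lookup x c
matched-∧ x {L} v (idle i refl) rewrite layer-idle x L i = refl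
matched-∧ x v (low {d} d∈ refl refl) rewrite layer-lo x v d∈ | layer-hi x v d∈ =
  ∧∨-∧ (lookup x (lo d)) (lookup x (hi d))
matched-∧ x {L} v (high {d} d∈ refl refl) =
  trans (∧-comm (lookup (applyLayer x L) (hi d)) _)
        (trans (matched-∧ x v (low d∈ refl refl)) (∧-comm (lookup x (lo d)) _))

matched-∨ : ∀ (x : Vec Bool n) {L a c} → ValidLayer L → Matched L a c →
  lookup (applyLayer x L) a ∨ lookup (applyLayer x L) c ≡ lookup x a ∨ lookup x c
matched-∨ x {L} v (idle i refl) rewrite layer-idle x L i = refl
matched-∨ x v (low {d} d∈ refl refl) rewrite layer-lo x v d∈ | layer-hi x v d∈ =
  ∧∨-∨ (lookup x (lo d)) (lookup x (hi d))
matched-∨ x {L} v (high {d} d∈ refl refl) =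
  trans (∨-comm (lookup (applyLayer x L) (hi d)) _)
        (trans (matched-∨ x v (low d∈ refl refl)) (∨-comm (lookup x (lo d)) _))

matched-sym : ∀ {L : Layer n} {a c} → Matched L a c → Matched L c a
matched-sym (idle i refl) = idle i refl
matched-sym (low d∈ p q) = high d∈ q p
matched-sym (high d∈ p q) = low d∈ q p

matched-unique : ∀ {L : Layer n} {a b c} → ValidLayer L → Matched L a b → Matched L a c → b ≡ c
matched-unique v (idle i refl) (idle _ refl) = refl
matched-unique v (idle i _) (low d∈ p _) = ⊥-elim (i d∈ (inj₁ p))
matched-unique v (idle i _) (high d∈ p _) = ⊥-elim (i d∈ (inj₂ p))
matched-unique v (low d∈ p _) (idle i _) = ⊥-elim (i d∈ (inj₁ p))
matched-unique v (high d∈ p _) (idle i _) = ⊥-elim (i d∈ (inj₂ p))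
matched-unique v (low d∈ p q) (low e∈ r s) with refl ← valid-unique v d∈ e∈ (inj₁ p) (inj₁ r) = trans q (sym s)
matched-unique v (low {d} d∈ p q) (high e∈ r s) with refl ← valid-unique v d∈ e∈ (inj₁ p) (inj₂ r) = ⊥-elim (lo≢hi d (trans (sym p) r))
matched-unique v (high {d} d∈ p q) (low e∈ r s) with refl ← valid-unique v d∈ e∈ (inj₂ p) (inj₁ r) = ⊥-elim (lo≢hi d (trans (sym r) p))
matched-unique v (high d∈ p q) (high e∈ r s) with refl ← valid-unique v d∈ e∈ (inj₂ p) (inj₂ r) = trans q (sym s)

-- Pulling z back along g again and again never returns to z, although the type is finite.
module _ {X : Set} {N : ℕ} (code : X → Fin N) (code-injective : ∀ {x y} → code x ≡ code y → x ≡ y)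
         {P : X → Set} (g : X → X) {z : X} (Pz : P z)
         (pull : ∀ {y} → P y → ∃ λ x → P x × x ≢ z × g x ≡ y) where

  private
    orbit : ℕ → ∃ P
    orbit zero = z , Pz
    orbit (suc k) with x , Px , _ ← pull (proj₂ (orbit k)) = x , Px

    point : ℕ → X
    point = proj₁ ∘ orbit

    point≢z : ∀ k → point (suc k) ≢ z
    point≢z k = proj₁ (proj₂ (proj₂ (pull (proj₂ (orbit k)))))

    g-point : ∀ k → g (point (suc k)) ≡ point k
    g-point k = proj₂ (proj₂ (proj₂ (pull (proj₂ (orbit k)))))

    -- Applying `g` lowers both indices by one, so two equal points reduce to `z` being equal to a
    -- later point, which `point≢z` excludes.
    point-distinct : ∀ i j → i ℕ.< j → point i ≢ point j
    point-distinct zero (suc j) _ e = point≢z j (sym e)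
    point-distinct (suc i) (suc j) (s≤s i<j) e =
      point-distinct i j i<j (trans (sym (g-point i)) (trans (cong g e) (g-point j)))

  no-proper-surjection : ⊥
  no-proper-surjection with i , j , i<j , e ← pigeonhole (ℕₚ.n<1+n N) (code ∘ point ∘ toℕ) =
    point-distinct (toℕ i) (toℕ j) i<j (code-injective e)

codeBits : Vec Bool n → Fin (2 ^ n)
codeBits x = funToFin (Inverse.from 2↔Bool ∘ lookup x)

codeBits-injective : {x y : Vec Bool n} → codeBits x ≡ codeBits y → x ≡ y
codeBits-injective {x = x} {y} e = lookup-injective x y λ i →
  trans (sym (Inverse.strictlyInverseˡ 2↔Bool (lookup x i)))
  (trans (cong (Inverse.to 2↔Bool)
     (trans (sym (finToFun-funToFin _ i)) (trans (cong (λ k → finToFun k i) e) (finToFun-funToFin _ i))))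
   (Inverse.strictlyInverseˡ 2↔Bool (lookup y i)))

-- Redundant two-layer networks

-- Channels are compared rather than comparators, which leaves the order proofs out of the decision;
-- `comparator-≡` recovers equality where it is needed.
Shared : Layer n → Layer n → Set
Shared F L = Any (λ d → Any (λ e → lo d ≡ lo e × hi d ≡ hi e) L) F

shared? : (F L : Layer n) → Dec (Shared F L)
shared? F L = any? (λ d → any? (λ e → (lo d ≟ lo e) ×-dec (hi d ≟ hi e)) L) F

-- All that the irredundancy arguments use about deleting a comparator from a valid layer, freed
-- from its position in the list.
record Deletion (L L' : Layer n) : Set where
  field
    {removed}    : Comparator n
    removed∈     : removed ∈ L
    kept⊆        : ∀ {e} → e ∈ L' → e ∈ L
    kept-disj    : ∀ {e} → e ∈ L' → Disjoint removed e
    split        : ∀ {e} → e ∈ L → e ≡ removed ⊎ e ∈ L'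
    kept-valid   : ValidLayer L'

DelOne-All : ∀ {A : Set} {P : A → Set} {xs ys : List A} → DelOne xs ys → All P xs → All P ys
DelOne-All here (_ ∷ a) = a
DelOne-All (there δ) (p ∷ a) = p ∷ DelOne-All δ a

deletion : ∀ {L L' : Layer n} → ValidLayer L → DelOne L L' → Deletion L L'
deletion {L' = L'} (a ∷ v) here = record
  { removed∈ = here refl ; kept⊆ = there ; kept-disj = All.lookup a
  ; split = λ { (here e) → inj₁ e ; (there e∈) → inj₂ e∈ } ; kept-valid = v }
deletion {n} {x ∷ xs} {x ∷ ys} (a ∷ v) (there δ) = record
  { removed∈ = there removed∈
  ; kept⊆ = λ { (here e) → here e ; (there e∈) → there (kept⊆ e∈) }
  ; kept-disj = λ { (here refl) → Disjoint-sym x removed (All.lookup a removed∈) ; (there e∈) → kept-disj e∈ }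
  ; split = λ { (here e) → inj₂ (here e) ; (there e∈) → [ inj₁ , inj₂ ∘ there ]′ (split e∈) }
  ; kept-valid = DelOne-All δ a ∷ kept-valid }
  where open Deletion (deletion v δ)

Sorted : Layer n → Vec Bool n → Set
Sorted F x = ∀ {d} → d ∈ F → SortedAt x d

false⇒SortedAt : ∀ (x : Vec Bool n) d → lookup x (lo d) ≡ false → SortedAt x d
false⇒SortedAt x d e e′ with () ← trans (sym e) e′

module _ {F : Layer n} (vF : ValidLayer F) where
  -- base is 0 on the lower and 1 on the upper channel of every comparator of F, so it stays
  -- sorted when a single channel of a comparator is changed.
  upper? : (c : Fin n) → Dec (Any (λ d → c ≡ hi d) F)
  upper? c = any? (λ d → c ≟ hi d) F

  base : Vec Bool n
  base = tabulate (does ∘ upper?)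

  base-lo : ∀ {d} → d ∈ F → lookup base (lo d) ≡ false
  base-lo {d} d∈ = trans (lookup∘tabulate _ (lo d)) (dec-false (upper? (lo d)) λ u →
    let e , e∈ , eq = find u in
    lo≢hi d (trans eq (cong hi (sym (valid-unique vF d∈ e∈ (inj₁ refl) (inj₂ eq))))))

  base-hi : ∀ {d} → d ∈ F → lookup base (hi d) ≡ true
  base-hi {d} d∈ = trans (lookup∘tabulate _ (hi d)) (dec-true (upper? (hi d)) (lose d∈ refl))

  module _ {L L' : Layer n} (vL : ValidLayer L) (¬s : ¬ Shared F L) (δ : Deletion L L') where
    open Deletion δ renaming (removed to c)

    private
      i = lo c
      j = hi c

      set : Bool → Bool → Vec Bool n
      set α β = (base [ i ]≔ α) [ j ]≔ β

      set-lo : ∀ α β → lookup (set α β) i ≡ α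
      set-lo α β = trans (lookup∘update′ (lo≢hi c) (base [ i ]≔ α) β) (lookup∘update i base α)

      set-hi : ∀ α β → lookup (set α β) j ≡ β
      set-hi α β = lookup∘update j (base [ i ]≔ α) β

      set-other : ∀ α β {k} → ¬ UsedBy k c → lookup (set α β) k ≡ lookup base k
      set-other α β nu = trans (lookup∘update′ (nu ∘ inj₂) (base [ i ]≔ α) β) (lookup∘update′ (nu ∘ inj₁) base α)

      -- A comparator of `F` on both `i` and `j` would be shared with `L`. Every other one keeps its
      -- 0 below or its 1 above, and either suffices for sortedness.
      set-sorted : ∀ α β → Sorted F (set α β)
      set-sorted α β {d} d∈ with usedBy? (lo d) c | usedBy? (hi d) c
      ... | _ | no nu = λ _ → trans (set-other α β nu) (base-hi d∈)
      ... | no nu | yes _ = false⇒SortedAt (set α β) d (trans (set-other α β nu) (base-lo d∈))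
      ... | yes (inj₁ p) | yes (inj₁ q) = ⊥-elim (lo≢hi d (trans p (sym q)))
      ... | yes (inj₂ p) | yes (inj₂ q) = ⊥-elim (lo≢hi d (trans p (sym q)))
      ... | yes (inj₁ p) | yes (inj₂ q) = ⊥-elim (¬s (lose d∈ (lose removed∈ (p , q))))
      ... | yes (inj₂ p) | yes (inj₁ q) =
        ⊥-elim (Finₚ.<-asym (lo<hi c) (subst₂ _<ᶠ_ p q (lo<hi d)))

      idle-i : Idle L' i
      idle-i e∈ = proj₁ (kept-disj e∈)

      idle-j : Idle L' j
      idle-j e∈ = proj₂ (kept-disj e∈)

      kept-unused : ∀ {e k} → e ∈ L' → UsedBy k e → ¬ UsedBy k c
      kept-unused {e} e∈ = Disjoint-used e c (Disjoint-sym c e (kept-disj e∈))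

      -- The comparators in `L'` avoid the channels of `c`, so `c` may act last wherever it stood in
      -- `L`. Outputs of `C` are thus the images under `c` of outputs of `C'`.
      restore : ∀ x → applyComparator (applyLayer x L') c ≡ applyLayer x L
      restore x = lookup-injective _ _ go
        where
        y = applyLayer x L'
        go : ∀ k → lookup (applyComparator y c) k ≡ lookup (applyLayer x L) k
        go k with match L k
        ... | _ , idle ik _ = trans (apply-other y c (ik removed∈))
                (trans (layer-idle x L' (ik ∘ kept⊆)) (sym (layer-idle x L ik)))
        ... | _ , low d∈ refl _ with split d∈
        ...   | inj₁ refl = trans (apply-lo y c) (trans
                (cong₂ _∧_ (layer-idle x L' idle-i) (layer-idle x L' idle-j)) (sym (layer-lo x vL d∈)))
        ...   | inj₂ e∈ = trans (apply-other y c (kept-unused e∈ (inj₁ refl)))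
                (trans (layer-lo x kept-valid e∈) (sym (layer-lo x vL d∈)))
        go k | _ , high d∈ refl _ with split d∈
        ...   | inj₁ refl = trans (apply-hi y c) (trans
                (cong₂ _∨_ (layer-idle x L' idle-i) (layer-idle x L' idle-j)) (sym (layer-hi x vL d∈)))
        ...   | inj₂ e∈ = trans (apply-other y c (kept-unused e∈ (inj₂ refl)))
                (trans (layer-hi x kept-valid e∈) (sym (layer-hi x vL d∈)))

      -- p and q have different images under L', which the removed comparator identifies.
      p = set true false
      q = set false true

      pq-other : ∀ {k} → ¬ UsedBy k c → lookup p k ≡ lookup q k
      pq-other nu = trans (set-other true false nu) (sym (set-other false true nu))

      merged : applyLayer p L ≡ applyLayer q L
      merged = lookup-injective _ _ go
        where
        go : ∀ k → lookup (applyLayer p L) k ≡ lookup (applyLayer q L) k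
        go k with match L k
        ... | _ , idle ik _ = trans (layer-idle p L ik)
                (trans (pq-other (ik removed∈)) (sym (layer-idle q L ik)))
        ... | _ , low d∈ refl _ rewrite layer-lo p vL d∈ | layer-lo q vL d∈ with split d∈
        ...   | inj₁ refl = trans (cong₂ _∧_ (set-lo true false) (set-hi true false))
                         (sym (cong₂ _∧_ (set-lo false true) (set-hi false true)))
        ...   | inj₂ e∈ = cong₂ _∧_ (pq-other (kept-unused e∈ (inj₁ refl))) (pq-other (kept-unused e∈ (inj₂ refl)))
        go k | _ , high d∈ refl _ rewrite layer-hi p vL d∈ | layer-hi q vL d∈ with split d∈
        ...   | inj₁ refl = trans (cong₂ _∨_ (set-lo true false) (set-hi true false))
                         (sym (cong₂ _∨_ (set-lo false true) (set-hi false true)))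
        ...   | inj₂ e∈ = cong₂ _∨_ (pq-other (kept-unused e∈ (inj₁ refl))) (pq-other (kept-unused e∈ (inj₂ refl)))

      y₁ = applyLayer p L'
      y₂ = applyLayer q L'

      y₁≢y₂ : y₁ ≢ y₂
      y₁≢y₂ e with () ← trans (sym (trans (layer-idle p L' idle-i) (set-lo true false)))
        (trans (cong (λ y → lookup y i) e) (trans (layer-idle q L' idle-i) (set-lo false true)))

      C C' : Network n
      C = F ∷ L ∷ []
      C' = F ∷ L' ∷ []

      out : ∀ α β → InOutputs C' (applyLayer (set α β) L')
      out α β = set α β , cong (λ x → applyLayer x L') (layer-sorted _ F (set-sorted α β))

    -- By `restore`, the assumed equality makes `c` followed by `π` a map of the outputs of `C'`
    -- onto themselves.
    second-layer-irredundant : (π : Permutation′ n) → ¬ (∀ y → InOutputs C' y ⇔ InPermOutputs π C y)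
    second-layer-irredundant π same =
      no-proper-surjection codeBits codeBits-injective {P = InOutputs C'}
        (λ x → permute π (applyComparator x c)) (out false true) pull
      where
      pull : ∀ {y} → InOutputs C' y → ∃ λ x → InOutputs C' x × x ≢ y₂ × permute π (applyComparator x c) ≡ y
      pull {y} Py with _ , (t , refl) , e ← Equivalence.to (same y) Py
                  with Vecₚ.≡-dec Boolₚ._≟_ (run C' t) y₂
      ... | no ne = run C' t , (t , refl) , ne , trans (cong (permute π) (restore (applyLayer t F))) e
      -- A preimage equal to `y₂` is replaced by `y₁`, which `c` sends to the same vector.
      ... | yes eq = y₁ , out true false , y₁≢y₂ ,
              trans (cong (permute π) (trans (restore p) (trans merged (trans (sym (restore q))
                (trans (cong (λ x → applyComparator x c) (sym eq)) (restore (applyLayer t F))))))) e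

  module _ {F' L : Layer n} (vL : ValidLayer L) (¬s : ¬ Shared F L) (δ : Deletion F F') where
    open Deletion δ renaming (removed to k)

    private
      a = lo k
      b = hi k
      c = proj₁ (match L a)
      d = proj₁ (match L b)
      a~c = proj₂ (match L a)
      b~d = proj₂ (match L b)

      -- The output z of p is not an output of C. If γ = 1, it has two ones on a, c and none on b, d,
      -- so a sorted preimage would be 1 on a and 0 on b. If F contains (c , d), p cannot be 1 on c;
      -- then γ = 0, a sorted preimage is 0 on b and d, hence on a and c, but z has a one on a, c.
      pair? : Dec (Any (λ e → c ≡ lo e × d ≡ hi e) F)
      pair? = any? (λ e → (c ≟ lo e) ×-dec (d ≟ hi e)) F

      C C' : Network n
      C = F ∷ L ∷ []
      C' = F' ∷ L ∷ []

      γ : Bool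
      γ = not (does pair?)

      -- `a` and `b` are written last, so their values prevail in the only possible coincidences,
      -- `c` = `a` and `d` = `b`, where an idle channel is its own partner.
      p : Vec Bool n
      p = (((base [ c ]≔ γ) [ d ]≔ false) [ a ]≔ true) [ b ]≔ false

      -- A comparator of `L` on `a` and `b` would repeat the deleted one. It follows that `a` and
      -- `b` have different partners and neither is the partner of the other.
      ¬a~b : ¬ Matched L a b
      ¬a~b (idle _ e) = lo≢hi k (sym e)
      ¬a~b (low e∈ r s) = ¬s (lose removed∈ (lose e∈ (r , s)))
      ¬a~b (high {e} e∈ r s) = Finₚ.<-asym (lo<hi k) (subst₂ _<ᶠ_ (sym s) (sym r) (lo<hi e))

      c≢d : c ≢ d
      c≢d e = lo≢hi k (matched-unique vL (matched-sym a~c) (subst (λ h → Matched L h b) (sym e) (matched-sym b~d)))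

      c≢b : c ≢ b
      c≢b e = ¬a~b (subst (Matched L a) e a~c)

      d≢a : d ≢ a
      d≢a e = ¬a~b (matched-sym (subst (Matched L b) e b~d))

      p-b : lookup p b ≡ false
      p-b = lookup∘update b (((base [ c ]≔ γ) [ d ]≔ false) [ a ]≔ true) false

      p-a : lookup p a ≡ true
      p-a = trans (lookup∘update′ (lo≢hi k) (((base [ c ]≔ γ) [ d ]≔ false) [ a ]≔ true) false)
                  (lookup∘update a ((base [ c ]≔ γ) [ d ]≔ false) true)

      p-other : ∀ {h} → ¬ UsedBy h k → lookup p h ≡ lookup ((base [ c ]≔ γ) [ d ]≔ false) h
      p-other nu = trans (lookup∘update′ (nu ∘ inj₂) (((base [ c ]≔ γ) [ d ]≔ false) [ a ]≔ true) false)
                         (lookup∘update′ (nu ∘ inj₁) ((base [ c ]≔ γ) [ d ]≔ false) true)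

      p-d : lookup p d ≡ false
      p-d with d ≟ b
      ... | yes e = trans (cong (lookup p) e) p-b
      ... | no ne = trans (p-other [ d≢a , ne ]′) (lookup∘update d (base [ c ]≔ γ) false)

      p-c : ¬ UsedBy c k → lookup p c ≡ γ
      p-c nu = trans (p-other nu) (trans (lookup∘update′ c≢d (base [ c ]≔ γ) false) (lookup∘update c base γ))

      p-rest : ∀ {h} → ¬ UsedBy h k → h ≢ c → h ≢ d → lookup p h ≡ lookup base h
      p-rest nu nc nd = trans (p-other nu) (trans (lookup∘update′ nd (base [ c ]≔ γ) false) (lookup∘update′ nc base γ))

      -- `F'` leaves `a` and `b` idle, so the values there impose nothing. Among the remaining
      -- comparators only one with lower channel `c` and upper channel `d` could be unsorted, and
      -- `γ` is 0 when `F` contains it.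
      p-sorted : Sorted F' p
      p-sorted {e} e∈ with lo e ≟ c | lo e ≟ d | hi e ≟ d | hi e ≟ c
      ... | _ | yes r | _ | _ = false⇒SortedAt p e (trans (cong (lookup p) r) p-d)
      ... | no nc | no nd | _ | _ =
        false⇒SortedAt p e (trans (p-rest (proj₁ (Disjoint-sym k e (kept-disj e∈))) nc nd) (base-lo (kept⊆ e∈)))
      ... | yes r | no _ | yes s | _ =
        false⇒SortedAt p e (trans (cong (lookup p) r)
          (trans (p-c (subst (λ h → ¬ UsedBy h k) r (proj₁ (Disjoint-sym k e (kept-disj e∈)))))
                 (cong not (dec-true pair? (lose (kept⊆ e∈) (sym r , sym s))))))
      ... | yes r | no _ | no nd | yes s = ⊥-elim (lo≢hi e (trans r (sym s)))
      ... | yes r | no _ | no nd | no nc = λ _ →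
        trans (p-rest (proj₂ (Disjoint-sym k e (kept-disj e∈))) nc nd) (base-hi (kept⊆ e∈))

      z = applyLayer p L

      Pz : InOutputs C' z
      Pz = p , cong (λ x → applyLayer x L) (layer-sorted p F' p-sorted)

      ∨-false : ∀ u v → u ∨ v ≡ false → u ≡ false × v ≡ false
      ∨-false false v e = refl , e

      ∧-trueˡ : ∀ u v → u ∧ v ≡ true → u ≡ true
      ∧-trueˡ true v e = refl

      unattained : ∀ x → Sorted F x → applyLayer x L ≢ z
      unattained x sx e = final pair?-cases
        where
        ∧-eq : lookup x a ∧ lookup x c ≡ lookup p a ∧ lookup p c
        ∧-eq = trans (sym (matched-∧ x vL a~c)) (trans (cong (λ y → lookup y a ∧ lookup y c) e) (matched-∧ p vL a~c))
        ∨-eq : lookup x a ∨ lookup x c ≡ true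
        ∨-eq = trans (sym (matched-∨ x vL a~c)) (trans (cong (λ y → lookup y a ∨ lookup y c) e)
          (trans (matched-∨ p vL a~c) (cong (_∨ lookup p c) p-a)))
        bd : lookup x b ≡ false × lookup x d ≡ false
        bd = ∨-false _ _ (trans (sym (matched-∨ x vL b~d)) (trans (cong (λ y → lookup y b ∨ lookup y d) e)
          (trans (matched-∨ p vL b~d) (cong₂ _∨_ p-b p-d))))
        xa : lookup x a ≡ false
        xa with lookup x a in eq
        ... | false = refl
        ... | true = trans (sym (sx removed∈ eq)) (proj₁ bd)
        xc : lookup x c ≡ true
        xc = trans (sym (cong (_∨ lookup x c) xa)) ∨-eq
        pair?-cases : Any (λ e → c ≡ lo e × d ≡ hi e) F ⊎ γ ≡ true
        pair?-cases with pair?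
        ... | yes y = inj₁ y
        ... | no _ = inj₂ refl
        final : Any (λ e → c ≡ lo e × d ≡ hi e) F ⊎ γ ≡ true → ⊥
        final (inj₁ an) with h , h∈ , r , s ← find an
          with () ← trans (sym (sx h∈ (trans (cong (lookup x) (sym r)) xc))) (trans (cong (lookup x) (sym s)) (proj₂ bd))
        final (inj₂ g) with c ≟ a
        ... | yes r with () ← trans (sym xa) (trans (cong (lookup x) (sym r)) xc)
        ... | no ca with () ← trans (sym xa) (∧-trueˡ _ _ (trans ∧-eq (cong₂ _∧_ p-a (trans (p-c [ ca , c≢b ]′) g))))

      -- A vector that has passed through `F` is sorted at every comparator of `F'`, hence fixed by
      -- `F'`, and can itself serve as the input of `C'`.
      C⊆C' : ∀ {y} → InOutputs C y → InOutputs C' y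
      C⊆C' (t , e) = applyLayer t F ,
        trans (cong (λ x → applyLayer x L) (layer-sorted _ F' (sorted-layer t vF ∘ kept⊆))) e

    -- Every output of `C'` is the image under `π` of an output of `C`. The latter is also an output
    -- of `C'` and differs from `z`, so `π` is onto without using `z`.
    first-layer-irredundant : (π : Permutation′ n) → ¬ (∀ y → InOutputs C' y ⇔ InPermOutputs π C y)
    first-layer-irredundant π same =
      no-proper-surjection codeBits codeBits-injective {P = InOutputs C'} (permute π) Pz pull
      where
      pull : ∀ {y} → InOutputs C' y → ∃ λ x → InOutputs C' x × x ≢ z × permute π x ≡ y
      pull {y} Py with x , (t , r) , e ← Equivalence.to (same y) Py =
        x , C⊆C' (t , r) , (λ s → unattained (applyLayer t F) (sorted-layer t vF) (trans r s)) , e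

redundant⇒shared : ∀ {F L : Layer n} → ValidLayer F → ValidLayer L → Redundant (F ∷ L ∷ []) → Shared F L
redundant⇒shared {F = F} {L} vF vL (_ , here δ , π , same) = decidable-stable (shared? F L) λ ¬s →
  first-layer-irredundant vF vL ¬s (deletion vF δ) π same
redundant⇒shared {F = F} {L} vF vL (_ , there (here δ) , π , same) = decidable-stable (shared? F L) λ ¬s →
  second-layer-irredundant vF vL ¬s (deletion vL δ) π same

-- Edge-labelled graphs

record Graph : Set₁ where
  constructor graph
  field
    V : Set
    E : Label → V → V → Set
open Graph

infix 4 _≅_
record _≅_ (G H : Graph) : Set where
  constructor iso
  field
    vertices : V G ↔ V H
    edges    : ∀ ℓ u v → E G ℓ u v ⇔ E H ℓ (Inverse.to vertices u) (Inverse.to vertices v)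

private variable G H K : Graph

≅-refl : G ≅ G
≅-refl = iso (↔-id _) λ _ _ _ → ⇔-id _

≅-sym : G ≅ H → H ≅ G
≅-sym {G} {H} (iso f e) = iso (↔-sym f) λ ℓ u v →
  ⇔-sym (subst₂ (λ x y → E G ℓ (from u) (from v) ⇔ E H ℓ x y) (strictlyInverseˡ u) (strictlyInverseˡ v) (e ℓ (from u) (from v)))
  where open Inverse f

≅-trans : G ≅ H → H ≅ K → G ≅ K
≅-trans (iso f e) (iso g h) = iso (g ↔-∘ f) λ ℓ u v → h ℓ _ _ ⇔-∘ e ℓ u v

-- The new vertices are the two copies of a comparator occurring in both layers.
addPair : Graph → Graph
addPair G = graph (Bool ⊎ V G) edge
  where
  arrow : Bool → Bool → Set
  arrow false true = ⊤
  arrow false false = ⊥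
  arrow true _ = ⊥
  edge : Label → Bool ⊎ V G → Bool ⊎ V G → Set
  edge ℓ (inj₁ b) (inj₁ b') = arrow b b'
  edge ℓ (inj₁ _) (inj₂ _) = ⊥
  edge ℓ (inj₂ _) (inj₁ _) = ⊥
  edge ℓ (inj₂ u) (inj₂ v) = E G ℓ u v

addPair-cong : G ≅ H → addPair G ≅ addPair H
addPair-cong {G} {H} (iso f e) = iso (↔-id Bool ⊎-↔ f) edge
  where
  edge : ∀ ℓ u v → E (addPair G) ℓ u v ⇔ E (addPair H) ℓ (Inverse.to (↔-id Bool ⊎-↔ f) u) (Inverse.to (↔-id Bool ⊎-↔ f) v)
  edge ℓ (inj₁ false) (inj₁ false) = ⇔-id _
  edge ℓ (inj₁ false) (inj₁ true) = ⇔-id _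
  edge ℓ (inj₁ true) (inj₁ _) = ⇔-id _
  edge ℓ (inj₁ _) (inj₂ _) = ⇔-id _
  edge ℓ (inj₂ _) (inj₁ _) = ⇔-id _
  edge ℓ (inj₂ u) (inj₂ v) = e ℓ u v

true-exitless : ∀ {ℓ} w → ¬ E (addPair G) ℓ (inj₁ true) w
true-exitless (inj₁ _) ()
true-exitless (inj₂ _) ()

-- Follow φ, and where it leads into the added pair, apply φ once more.
data Reroute {A B : Set} (φ : Bool ⊎ A → Bool ⊎ B) (x : A) (y : B) : Set where
  direct : φ (inj₂ x) ≡ inj₂ y → Reroute φ x y
  detour : ∀ b → φ (inj₂ x) ≡ inj₁ b → φ (inj₁ b) ≡ inj₂ y → Reroute φ x y

module _ (φ : addPair G ≅ addPair H) where
  open Inverse (_≅_.vertices φ)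

  private
    edge : ∀ {ℓ u v u' v'} → to u ≡ u' → to v ≡ v' → E (addPair G) ℓ u v ⇔ E (addPair H) ℓ u' v'
    edge refl refl = _≅_.edges φ _ _ _

    back : ∀ {u v} → to u ≡ v → from v ≡ u
    back refl = strictlyInverseʳ _

  -- If `b'` = `b`, two vertices share an image. Otherwise the source of the pair goes to the sink
  -- or the sink to the source, although the source has an outgoing edge and the sink has none.
  detour-leaves : ∀ {x} b b' → to (inj₂ x) ≡ inj₁ b → to (inj₁ b) ≢ inj₁ b'
  detour-leaves false false p q with () ← trans (sym (back p)) (back q)
  detour-leaves true true p q with () ← trans (sym (back p)) (back q)
  detour-leaves false true p q = true-exitless {H} (to (inj₁ true)) (Equivalence.to (edge {one} q refl) tt)
  detour-leaves true false p q =
    true-exitless {G} (from (inj₁ true)) (Equivalence.from (edge {one} q (strictlyInverseˡ (inj₁ true))) tt)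

  reroute : ∀ x → ∃ (Reroute to x)
  reroute x with to (inj₂ x) in p
  ... | inj₂ y = y , direct p
  ... | inj₁ b with to (inj₁ b) in q
  ...   | inj₂ y = y , detour b p q
  ...   | inj₁ b' = ⊥-elim (detour-leaves b b' p q)

  reroute-unique : ∀ {x y y'} → Reroute to x y → Reroute to x y' → y ≡ y'
  reroute-unique (direct p) (direct q) = inj₂-injective (trans (sym p) q)
  reroute-unique (direct p) (detour b q _) with () ← trans (sym p) q
  reroute-unique (detour b q _) (direct p) with () ← trans (sym p) q
  reroute-unique (detour b p q) (detour b' p' q') with refl ← inj₁-injective (trans (sym p) p') =
    inj₂-injective (trans (sym q) q')

  -- A detour read backwards is a detour of the inverse through the same end of the pair. Rerouting
  -- the inverse therefore inverts the rerouting.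
  reroute-sym : ∀ {x y} → Reroute to x y → Reroute from y x
  reroute-sym (direct p) = direct (back p)
  reroute-sym (detour b p q) = detour b (back q) (back p)

  -- The two equivalences compose because adjacency involving an end of the added pair does not
  -- depend on the graph: among the ends it is `arrow`, and between an end and an old vertex it is
  -- empty.
  reroute-edge : ∀ {ℓ x x' y y'} → Reroute to x y → Reroute to x' y' → E G ℓ x x' ⇔ E H ℓ y y'
  reroute-edge (direct p) (direct q) = edge p q
  reroute-edge (direct p) (detour b q r) = edge p r ⇔-∘ edge p q
  reroute-edge (detour b q r) (direct p) = edge r p ⇔-∘ edge q p
  reroute-edge (detour b p q) (detour b' p' q') = edge q q' ⇔-∘ edge p p'

addPair-cancel : addPair G ≅ addPair H → G ≅ H
addPair-cancel {G} {H} φ = iso (mk↔ₛ′ to from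
    (λ y → reroute-unique φ (proj₂ (reroute φ (from y))) (reroute-sym ψ (proj₂ (reroute ψ y))))
    (λ x → reroute-unique ψ (proj₂ (reroute ψ (to x))) (reroute-sym φ (proj₂ (reroute φ x)))))
  λ ℓ u v → reroute-edge φ (proj₂ (reroute φ u)) (proj₂ (reroute φ v))
  where
  ψ = ≅-sym φ
  to = proj₁ ∘ reroute φ
  from = proj₁ ∘ reroute ψ

private variable m k : ℕ

-- Graphs of two-layer networks

networkGraph : Network n → Graph
networkGraph C = graph (Vertex C) (Edge C)

netGraph : TwoLayer n → Graph
netGraph a = networkGraph (net a)

-- With two layers the condition on intermediate layers in `Edge` is vacuous. What remains is a
-- bipartite incidence relation, which is decidable at sight.
twoLayerGraph : Layer n → Layer n → Graph
twoLayerGraph F L = graph (Fin (length F) ⊎ Fin (length L)) edge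
  where
  edge : Label → Fin (length F) ⊎ Fin (length L) → Fin (length F) ⊎ Fin (length L) → Set
  edge ℓ (inj₁ a) (inj₁ _) = ⊥
  edge ℓ (inj₁ a) (inj₂ b) = UsedBy (labChan ℓ (List.lookup F a)) (List.lookup L b)
  edge ℓ (inj₂ _) _ = ⊥

networkGraph≅twoLayerGraph : (F L : Layer n) → networkGraph (F ∷ L ∷ []) ≅ twoLayerGraph F L
networkGraph≅twoLayerGraph F L = iso (mk↔ₛ′ to from to-from from-to) edge
  where
  C = F ∷ L ∷ []
  to : Vertex C → Fin (length F) ⊎ Fin (length L)
  to (fz , a) = inj₁ a
  to (fs fz , b) = inj₂ b
  from : Fin (length F) ⊎ Fin (length L) → Vertex C
  from (inj₁ a) = fz , a
  from (inj₂ b) = fs fz , b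
  to-from : ∀ v → to (from v) ≡ v
  to-from (inj₁ a) = refl
  to-from (inj₂ b) = refl
  from-to : ∀ v → from (to v) ≡ v
  from-to (fz , a) = refl
  from-to (fs fz , b) = refl
  edge : ∀ ℓ u v → Edge C ℓ u v ⇔ E (twoLayerGraph F L) ℓ (to u) (to v)
  edge ℓ (fz , a) (fz , b) = mk⇔ (λ { (() , _) }) (λ ())
  edge ℓ (fz , a) (fs fz , b) = mk⇔ (proj₁ ∘ proj₂)
    λ u → s≤s z≤n , u , λ h 0<h h<1 → ⊥-elim (ℕₚ.<-irrefl refl (ℕₚ.<-≤-trans 0<h (ℕₚ.≤-pred h<1)))
  edge ℓ (fs fz , a) (fz , b) = mk⇔ (λ { (() , _) }) (λ ())
  edge ℓ (fs fz , a) (fs fz , b) = mk⇔ (λ { (s≤s () , _) }) (λ ())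

comparator-≡ : {d e : Comparator n} → lo d ≡ lo e → hi d ≡ hi e → d ≡ e
comparator-≡ {d = comp i j p} {comp .i .j q} refl refl = cong (comp i j) (ℕₚ.<-irrelevant p q)

-- Align ι d k L L' : L consists of the image of L' under ι, interspersed with k copies of d.
data Align (ι : Fin m → Fin n) (d : Comparator n) : ℕ → Layer n → Layer m → Set where
  []  : Align ι d 0 [] []
  new : ∀ {L L'} → Align ι d k L L' → Align ι d (suc k) (d ∷ L) L'
  old : ∀ {c c' L L'} → lo c ≡ ι (lo c') → hi c ≡ ι (hi c') →
        Align ι d k L L' → Align ι d k (c ∷ L) (c' ∷ L')

module _ {ι : Fin m → Fin n} {d : Comparator n} where

  position : ∀ {L L'} → Align ι d k L L' → Fin k ⊎ Fin (length L') → Fin (length L)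
  position (new al) (inj₁ fz) = fz
  position (new al) (inj₁ (fs j)) = fs (position al (inj₁ j))
  position (new al) (inj₂ j) = fs (position al (inj₂ j))
  position (old _ _ al) (inj₁ j) = fs (position al (inj₁ j))
  position (old _ _ al) (inj₂ fz) = fz
  position (old _ _ al) (inj₂ (fs j)) = fs (position al (inj₂ j))

  origin : ∀ {L L'} → Align ι d k L L' → Fin (length L) → Fin k ⊎ Fin (length L')
  origin (new al) fz = inj₁ fz
  origin (new al) (fs i) = map₁ fs (origin al i)
  origin (old _ _ al) fz = inj₂ fz
  origin (old _ _ al) (fs i) = map₂ fs (origin al i)

  origin-position : ∀ {L L'} (al : Align ι d k L L') j → origin al (position al j) ≡ j
  origin-position (new al) (inj₁ fz) = refl
  origin-position (new al) (inj₁ (fs j)) rewrite origin-position al (inj₁ j) = refl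
  origin-position (new al) (inj₂ j) rewrite origin-position al (inj₂ j) = refl
  origin-position (old _ _ al) (inj₁ j) rewrite origin-position al (inj₁ j) = refl
  origin-position (old _ _ al) (inj₂ fz) = refl
  origin-position (old _ _ al) (inj₂ (fs j)) rewrite origin-position al (inj₂ j) = refl

  position-origin : ∀ {L L'} (al : Align ι d k L L') i → position al (origin al i) ≡ i
  position-origin (new al) fz = refl
  position-origin (new al) (fs i) with origin al i in eq
  ... | inj₁ j = cong fs (trans (cong (position al) (sym eq)) (position-origin al i))
  ... | inj₂ j = cong fs (trans (cong (position al) (sym eq)) (position-origin al i))
  position-origin (old _ _ al) fz = refl
  position-origin (old _ _ al) (fs i) with origin al i in eq
  ... | inj₁ j = cong fs (trans (cong (position al) (sym eq)) (position-origin al i))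
  ... | inj₂ j = cong fs (trans (cong (position al) (sym eq)) (position-origin al i))

  positions : ∀ {L L'} → Align ι d k L L' → (Fin k ⊎ Fin (length L')) ↔ Fin (length L)
  positions al = mk↔ₛ′ (position al) (origin al) (position-origin al) (origin-position al)

  lookup-new : ∀ {L L'} (al : Align ι d k L L') j → List.lookup L (position al (inj₁ j)) ≡ d
  lookup-new (new al) fz = refl
  lookup-new (new al) (fs j) = lookup-new al j
  lookup-new (old _ _ al) j = lookup-new al j

  lookup-old : ∀ {L L'} (al : Align ι d k L L') ℓ j →
    labChan ℓ (List.lookup L (position al (inj₂ j))) ≡ ι (labChan ℓ (List.lookup L' j))
  lookup-old (new al) ℓ j = lookup-old al ℓ j
  lookup-old (old p q al) one fz = p
  lookup-old (old p q al) two fz = q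
  lookup-old (old _ _ al) ℓ (fs j) = lookup-old al ℓ j

  module _ (ι-injective : ∀ {a b} → ι a ≡ ι b → a ≡ b) where

    usedBy-old : ∀ {c c' e e'} → c ≡ ι c' → lo e ≡ ι (lo e') → hi e ≡ ι (hi e') → UsedBy c' e' → UsedBy c e
    usedBy-old p q r (inj₁ refl) = inj₁ (trans p (sym q))
    usedBy-old p q r (inj₂ refl) = inj₂ (trans p (sym r))

    usedBy-old⁻ : ∀ {c c' e e'} → c ≡ ι c' → lo e ≡ ι (lo e') → hi e ≡ ι (hi e') → UsedBy c e → UsedBy c' e'
    usedBy-old⁻ p q r (inj₁ u) = inj₁ (ι-injective (trans (sym p) (trans u q)))
    usedBy-old⁻ p q r (inj₂ u) = inj₂ (ι-injective (trans (sym p) (trans u r)))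

    align-valid : ∀ {L L'} → Align ι d k L L' → ValidLayer L → ValidLayer L'
    align-valid [] v = []
    align-valid (new al) (_ ∷ v) = align-valid al v
    align-valid (old {c = c} {c'} p q al) (a ∷ v) = all al a ∷ align-valid al v
      where
      all : ∀ {k L L'} → Align ι d k L L' → All (Disjoint c) L → All (Disjoint c') L'
      all [] a = []
      all (new al) (_ ∷ a) = all al a
      all (old {c = e} {e'} r s al) ((x , y) ∷ a) =
        ((λ u → x (usedBy-old {e = e} {e'} p r s u)) , (λ u → y (usedBy-old {e = e} {e'} q r s u))) ∷ all al a

    module _ (ι-avoids : ∀ a → ¬ UsedBy (ι a) d)
             {F F' L L'} (alF : Align ι d 1 F F') (alL : Align ι d 1 L L') where
      private
        Γ = addPair (twoLayerGraph F' L')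
        Δ = twoLayerGraph F L

        -- `false` is the first-layer copy and `true` the second-layer copy, in agreement with the
        -- direction of the added edges.
        regroup : ∀ {A B : Set} → (Bool ⊎ (A ⊎ B)) ↔ ((Fin 1 ⊎ A) ⊎ (Fin 1 ⊎ B))
        regroup = mk↔ₛ′
          (λ { (inj₁ false) → inj₁ (inj₁ fz) ; (inj₁ true) → inj₂ (inj₁ fz)
             ; (inj₂ (inj₁ a)) → inj₁ (inj₂ a) ; (inj₂ (inj₂ b)) → inj₂ (inj₂ b) })
          (λ { (inj₁ (inj₁ fz)) → inj₁ false ; (inj₂ (inj₁ fz)) → inj₁ true
             ; (inj₁ (inj₂ a)) → inj₂ (inj₁ a) ; (inj₂ (inj₂ b)) → inj₂ (inj₂ b) })
          (λ { (inj₁ (inj₁ fz)) → refl ; (inj₂ (inj₁ fz)) → refl ; (inj₁ (inj₂ a)) → refl ; (inj₂ (inj₂ b)) → refl })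
          (λ { (inj₁ false) → refl ; (inj₁ true) → refl ; (inj₂ (inj₁ a)) → refl ; (inj₂ (inj₂ b)) → refl })

        f : V Γ ↔ V Δ
        f = (positions alF ⊎-↔ positions alL) ↔-∘ regroup

        labChan-used : ∀ ℓ (e : Comparator n) → UsedBy (labChan ℓ e) e
        labChan-used one e = inj₁ refl
        labChan-used two e = inj₂ refl

        old-avoids : ∀ {c c'} → c ≡ ι c' → ¬ UsedBy c d
        old-avoids refl = ι-avoids _

        -- `ι-avoids` isolates the two copies of `d`; injectivity of `ι` reflects the remaining
        -- incidences.
        edge : ∀ ℓ u v → E Γ ℓ u v ⇔ E Δ ℓ (Inverse.to f u) (Inverse.to f v)
        edge ℓ (inj₁ false) (inj₁ false) = ⇔-id _
        edge ℓ (inj₁ false) (inj₁ true) = mk⇔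
          (λ _ → subst₂ (λ e e' → UsedBy (labChan ℓ e) e') (sym (lookup-new alF fz)) (sym (lookup-new alL fz)) (labChan-used ℓ d))
          (λ _ → tt)
        edge ℓ (inj₁ false) (inj₂ (inj₁ a)) = ⇔-id _
        edge ℓ (inj₁ false) (inj₂ (inj₂ b)) = mk⇔ (λ ()) λ u → avoid (subst (λ e → UsedBy (labChan ℓ e) e') (lookup-new alF fz) u)
          where
          e' = List.lookup L (position alL (inj₂ b))
          avoid : ¬ UsedBy (labChan ℓ d) e'
          avoid (inj₁ p) = old-avoids (trans p (lookup-old alL one b)) (labChan-used ℓ d)
          avoid (inj₂ p) = old-avoids (trans p (lookup-old alL two b)) (labChan-used ℓ d)
        edge ℓ (inj₁ true) (inj₁ _) = ⇔-id _
        edge ℓ (inj₁ true) (inj₂ _) = ⇔-id _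
        edge ℓ (inj₂ (inj₁ a)) (inj₁ false) = ⇔-id _
        edge ℓ (inj₂ (inj₁ a)) (inj₁ true) = mk⇔ (λ ())
          λ u → old-avoids (lookup-old alF ℓ a) (subst (UsedBy _) (lookup-new alL fz) u)
        edge ℓ (inj₂ (inj₁ a)) (inj₂ (inj₁ _)) = ⇔-id _
        edge ℓ (inj₂ (inj₁ a)) (inj₂ (inj₂ b)) = mk⇔
          (usedBy-old {e = e} {e'} (lookup-old alF ℓ a) (lookup-old alL one b) (lookup-old alL two b))
          (usedBy-old⁻ {e = e} {e'} (lookup-old alF ℓ a) (lookup-old alL one b) (lookup-old alL two b))
          where
          e = List.lookup L (position alL (inj₂ b))
          e' = List.lookup L' b
        edge ℓ (inj₂ (inj₂ _)) (inj₁ _) = ⇔-id _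
        edge ℓ (inj₂ (inj₂ _)) (inj₂ _) = ⇔-id _

      align-graph : addPair (networkGraph (F' ∷ L' ∷ [])) ≅ networkGraph (F ∷ L ∷ [])
      align-graph = ≅-trans (addPair-cong (networkGraph≅twoLayerGraph F' L'))
        (≅-trans (iso f edge) (≅-sym (networkGraph≅twoLayerGraph F L)))

-- Removing and adding a repeated comparator

-- The order embedding of `m` channels whose gap is the channels of `d`. Monotonicity lets
-- comparators be pulled back with their ends in the right order. `ι-first` says that closing the
-- gap leaves a standard first layer, which ties `d` to that layer.
record Skip (m : ℕ) (d : Comparator (2 ℕ.+ m)) : Set where
  field
    ι        : Fin m → Fin (2 ℕ.+ m)
    ι-mono   : ∀ {a b} → a <ᶠ b → ι a <ᶠ ι b
    ι-avoids : ∀ a → ¬ UsedBy (ι a) d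
    ι-covers : ∀ c → ¬ UsedBy c d → ∃ λ a → c ≡ ι a
    ι-first  : Align ι d 1 (firstLayer (2 ℕ.+ m)) (firstLayer m)

  ι-injective : ∀ {a b} → ι a ≡ ι b → a ≡ b
  ι-injective {a} {b} e with Finₚ.<-cmp a b
  ... | tri< a<b _ _ = ⊥-elim (Finₚ.<⇒≢ (ι-mono a<b) e)
  ... | tri≈ _ a≡b _ = a≡b
  ... | tri> _ _ b<a = ⊥-elim (Finₚ.<⇒≢ (ι-mono b<a) (sym e))

  ι-cancel-< : ∀ {a b} → ι a <ᶠ ι b → a <ᶠ b
  ι-cancel-< {a} {b} l with Finₚ.<-cmp a b
  ... | tri< a<b _ _ = a<b
  ... | tri≈ _ refl _ = ⊥-elim (Finₚ.<⇒≢ l refl)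
  ... | tri> _ _ b<a = ⊥-elim (Finₚ.<-asym l (ι-mono b<a))

align-shift : ∀ (d : Comparator (2 ℕ.+ m)) L → Align (λ c → fs (fs c)) d 0 (map shift2 L) L
align-shift d [] = []
align-shift d (c ∷ L) = old refl refl (align-shift d L)

firstComparator : Comparator (2 ℕ.+ m)
firstComparator = comp fz (fs fz) (s≤s z≤n)

skipFirst : Skip m firstComparator
skipFirst = record
  { ι = λ c → fs (fs c)
  ; ι-mono = λ l → s≤s (s≤s l)
  ; ι-avoids = λ { _ (inj₁ ()) ; _ (inj₂ ()) }
  ; ι-covers = λ { fz nu → ⊥-elim (nu (inj₁ refl)) ; (fs fz) nu → ⊥-elim (nu (inj₂ refl)) ; (fs (fs c)) nu → c , refl }
  ; ι-first = new (align-shift _ (firstLayer _)) }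

-- The first two channels carry another first-layer comparator, so they stay fixed and the given
-- embedding acts beyond them.
skipLater : ∀ {d} → Skip m d → Skip (2 ℕ.+ m) (shift2 d)
skipLater {m} {d} S = record
  { ι = ι' ; ι-mono = λ {a} {b} → mono {a} {b} ; ι-avoids = avoids ; ι-covers = covers ; ι-first = old refl refl (align-map ι-first) }
  where
  open Skip S
  ι' : Fin (2 ℕ.+ m) → Fin (4 ℕ.+ m)
  ι' fz = fz
  ι' (fs fz) = fs fz
  ι' (fs (fs c)) = fs (fs (ι c))
  mono : ∀ {a b} → a <ᶠ b → ι' a <ᶠ ι' b
  mono {fz} {fs fz} _ = s≤s z≤n
  mono {fz} {fs (fs b)} _ = s≤s z≤n
  mono {fs fz} {fs fz} (s≤s ())
  mono {fs fz} {fs (fs b)} _ = s≤s (s≤s z≤n)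
  mono {fs (fs a)} {fs fz} (s≤s ())
  mono {fs (fs a)} {fs (fs b)} (s≤s (s≤s l)) = s≤s (s≤s (ι-mono l))
  avoids : ∀ a → ¬ UsedBy (ι' a) (shift2 d)
  avoids fz (inj₁ ())
  avoids fz (inj₂ ())
  avoids (fs fz) (inj₁ ())
  avoids (fs fz) (inj₂ ())
  avoids (fs (fs a)) (inj₁ e) = ι-avoids a (inj₁ (Finₚ.suc-injective (Finₚ.suc-injective e)))
  avoids (fs (fs a)) (inj₂ e) = ι-avoids a (inj₂ (Finₚ.suc-injective (Finₚ.suc-injective e)))
  covers : ∀ c → ¬ UsedBy c (shift2 d) → ∃ λ a → c ≡ ι' a
  covers fz _ = fz , refl
  covers (fs fz) _ = fs fz , refl
  covers (fs (fs c)) nu with a , e ← ι-covers c (nu ∘ Sum.map (cong (fs ∘ fs)) (cong (fs ∘ fs))) = fs (fs a) , cong (fs ∘ fs) e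
  align-map : ∀ {k L L'} → Align ι d k L L' → Align ι' (shift2 d) k (map shift2 L) (map shift2 L')
  align-map [] = []
  align-map (new al) = new (align-map al)
  align-map (old p q al) = old (cong (fs ∘ fs) p) (cong (fs ∘ fs) q) (align-map al)

skip : ∀ m {d} → d ∈ firstLayer (2 ℕ.+ m) → Skip m d
skip m (here refl) = skipFirst
skip (suc (suc m)) (there d∈) with _ , d'∈ , refl ← ∈-map⁻ shift2 d∈ = skipLater (skip m d'∈)

module _ {d : Comparator (2 ℕ.+ m)} (S : Skip m d) where
  open Skip S

  -- Disjointness from `d` puts both ends of a comparator in the range of `ι`. Validity makes this
  -- apply to everything after the one occurrence of `d`.
  erase-disjoint : ∀ {L} → All (Disjoint d) L → ∃ (Align ι d 0 L)
  erase-disjoint [] = [] , []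
  erase-disjoint {c ∷ L} (dj ∷ a)
    with L' , al ← erase-disjoint a
    with i , p ← ι-covers (lo c) (proj₁ (Disjoint-sym d c dj))
    with j , q ← ι-covers (hi c) (proj₂ (Disjoint-sym d c dj)) =
    comp i j (ι-cancel-< (subst₂ _<ᶠ_ p q (lo<hi c))) ∷ L' , old p q al

  erase : ∀ {L} → ValidLayer L → d ∈ L → ∃ (Align ι d 1 L)
  erase (a ∷ v) (here refl) with L' , al ← erase-disjoint a = L' , new al
  erase {c ∷ L} (a ∷ v) (there d∈)
    with L' , al ← erase v d∈
    with i , p ← ι-covers (lo c) (proj₁ (All.lookup a d∈))
    with j , q ← ι-covers (hi c) (proj₂ (All.lookup a d∈)) =
    comp i j (ι-cancel-< (subst₂ _<ᶠ_ p q (lo<hi c))) ∷ L' , old p q al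

shift2-disjoint : ∀ (c d : Comparator n) → Disjoint c d → Disjoint (shift2 c) (shift2 d)
shift2-disjoint _ d (p , q) = p ∘ unshift , q ∘ unshift
  where
  unshift : ∀ {c} → UsedBy (fs (fs c)) (shift2 d) → UsedBy c d
  unshift (inj₁ refl) = inj₁ refl
  unshift (inj₂ refl) = inj₂ refl

extend-valid : ∀ {L : Layer n} → ValidLayer L → ValidLayer (firstComparator ∷ map shift2 L)
extend-valid v = Allₚ.map⁺ (All.universal (λ _ → (λ { (inj₁ ()) ; (inj₂ ()) }) , (λ { (inj₁ ()) ; (inj₂ ()) })) _) ∷ shifted v
  where
  shifted : ∀ {L} → ValidLayer L → ValidLayer (map shift2 L)
  shifted [] = []
  shifted {c ∷ _} (a ∷ v) = Allₚ.map⁺ (All.map (λ {d} → shift2-disjoint c d) a) ∷ shifted v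

firstLayer-valid : ∀ n → ValidLayer (firstLayer n)
firstLayer-valid zero = []
firstLayer-valid (suc zero) = []
firstLayer-valid (suc (suc n)) = extend-valid (firstLayer-valid n)

-- The repeated comparator sits on the first two channels, where the embedding is a plain shift. Its
-- second copy meets sorted values, so deleting it changes nothing and the identity permutation
-- witnesses redundancy.
extend : TwoLayer m → RedundantTwoLayer (2 ℕ.+ m)
extend {m} (L , v) = (firstComparator ∷ map shift2 L , extend-valid v) ,
  F ∷ map shift2 L ∷ [] , there (here here) , Perm.id ,
  λ y → mk⇔ (λ (x , e) → y , (x , trans (same x) e) , tabulate∘lookup y)
            (λ (z , (x , e) , r) → x , trans (sym (same x)) (trans e (trans (sym (tabulate∘lookup z)) r)))
  where
  F = firstLayer (2 ℕ.+ m)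
  same : ∀ x → run (F ∷ (firstComparator ∷ map shift2 L) ∷ []) x ≡ run (F ∷ map shift2 L ∷ []) x
  same x = cong (λ y → applyLayer y (map shift2 L))
    (apply-sorted (applyLayer x F) firstComparator (sorted-layer x (firstLayer-valid (2 ℕ.+ m)) (here refl)))

extend-graph : (a : TwoLayer m) → addPair (netGraph a) ≅ netGraph (proj₁ (extend a))
extend-graph (L , _) = align-graph ι-injective ι-avoids ι-first (new (align-shift _ L))
  where open Skip skipFirst

-- The result depends on which shared comparator is found, but by `addPair-cancel` its isomorphism
-- class does not.
reduce : (c : RedundantTwoLayer (2 ℕ.+ m)) →
         Σ (TwoLayer m) λ a → addPair (netGraph a) ≅ netGraph (proj₁ c)
reduce {m} ((L , v) , red)
  with d , d∈F , s ← find (redundant⇒shared (firstLayer-valid (2 ℕ.+ m)) v red)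
  with e , e∈L , p , q ← find s
  with refl ← comparator-≡ {d = d} {e} p q
  with S ← skip m d∈F
  with L' , al ← erase S v e∈L =
  (L' , align-valid (Skip.ι-injective S) al v) ,
  align-graph (Skip.ι-injective S) (Skip.ι-avoids S) (Skip.ι-first S) al

-- Deciding isomorphism of finite graphs

anyVec? : ∀ n {P : Vec (Fin m) n → Set} → (∀ v → Dec (P v)) → Dec (∃ P)
anyVec? zero P? = map′ (λ p → [] , p) (λ { ([] , p) → p }) (P? [])
anyVec? (suc n) P? = map′ (λ (x , v , p) → x ∷ v , p) (λ { (x ∷ v , p) → x , v , p })
  (Finₚ.any? λ x → anyVec? n λ v → P? (x ∷ v))

_⇔?_ : ∀ {A B : Set} → Dec A → Dec B → Dec (A ⇔ B)
a? ⇔? b? = map′ (λ (f , g) → mk⇔ f g) (λ e → Equivalence.to e , Equivalence.from e)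
  ((a? →-dec b?) ×-dec (b? →-dec a?))

allLabels? : {P : Label → Set} → (∀ ℓ → Dec (P ℓ)) → Dec (∀ ℓ → P ℓ)
allLabels? P? = map′ (λ { (p , q) one → p ; (p , q) two → q }) (λ f → f one , f two) (P? one ×-dec P? two)

module _ {n m : ℕ} (E₁ : Label → Fin n → Fin n → Set) (E₂ : Label → Fin m → Fin m → Set)
         (E₁? : ∀ ℓ i j → Dec (E₁ ℓ i j)) (E₂? : ∀ ℓ i j → Dec (E₂ ℓ i j)) where

  private
    Table : Vec (Fin m) n → Vec (Fin n) m → Set
    Table v w = (∀ j → lookup v (lookup w j) ≡ j) × (∀ i → lookup w (lookup v i) ≡ i) ×
                (∀ ℓ i j → E₁ ℓ i j ⇔ E₂ ℓ (lookup v i) (lookup v j))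

    table? : ∀ v w → Dec (Table v w)
    table? v w = Finₚ.all? (λ j → lookup v (lookup w j) ≟ j) ×-dec Finₚ.all? (λ i → lookup w (lookup v i) ≟ i) ×-dec
      allLabels? λ ℓ → Finₚ.all? λ i → Finₚ.all? λ j → E₁? ℓ i j ⇔? E₂? ℓ (lookup v i) (lookup v j)

  -- An isomorphism is tabulated as two mutually inverse vectors, and there are only finitely many
  -- pairs of vectors to try.
  finGraph-≅? : Dec (graph (Fin n) E₁ ≅ graph (Fin m) E₂)
  finGraph-≅? = map′ fromTable toTable (anyVec? n λ v → anyVec? m λ w → table? v w)
    where
    fromTable : ∃₂ Table → graph (Fin n) E₁ ≅ graph (Fin m) E₂
    fromTable (v , w , p , q , e) = iso (mk↔ₛ′ (lookup v) (lookup w) p q) e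
    toTable : graph (Fin n) E₁ ≅ graph (Fin m) E₂ → ∃₂ Table
    toTable (iso f e) = tabulate to , tabulate from ,
      (λ j → trans (lookup∘tabulate to _) (trans (cong to (lookup∘tabulate from j)) (strictlyInverseˡ j))) ,
      (λ i → trans (lookup∘tabulate from _) (trans (cong from (lookup∘tabulate to i)) (strictlyInverseʳ i))) ,
      (λ ℓ i j → subst₂ (λ a b → E₁ ℓ i j ⇔ E₂ ℓ a b) (sym (lookup∘tabulate to i)) (sym (lookup∘tabulate to j)) (e ℓ i j))
      where open Inverse f

relabel : ∀ (G : Graph) {W : Set} (f : W ↔ V G) → graph W (λ ℓ u v → E G ℓ (Inverse.to f u) (Inverse.to f v)) ≅ G
relabel G f = iso f λ _ _ _ → ⇔-id _

≅-dec : Fin n ↔ V G → Fin m ↔ V H → (∀ ℓ u v → Dec (E G ℓ u v)) → (∀ ℓ u v → Dec (E H ℓ u v)) → Dec (G ≅ H)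
≅-dec {G = G} {H = H} f g E₁? E₂? = map′
  (λ φ → ≅-trans (≅-sym (relabel G f)) (≅-trans φ (relabel H g)))
  (λ φ → ≅-trans (relabel G f) (≅-trans φ (≅-sym (relabel H g))))
  (finGraph-≅? _ _ (λ ℓ _ _ → E₁? ℓ _ _) (λ ℓ _ _ → E₂? ℓ _ _))

twoLayerEdge? : ∀ (F L : Layer n) ℓ u v → Dec (E (twoLayerGraph F L) ℓ u v)
twoLayerEdge? F L ℓ (inj₁ a) (inj₁ b) = no λ ()
twoLayerEdge? F L ℓ (inj₁ a) (inj₂ b) = usedBy? _ (List.lookup L b)
twoLayerEdge? F L ℓ (inj₂ a) v = no λ ()

netGraph-≅? : (a b : TwoLayer n) → Dec (netGraph a ≅ netGraph b)
netGraph-≅? {n} a b = map′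
  (λ φ → ≅-trans (simplify a) (≅-trans φ (≅-sym (simplify b))))
  (λ φ → ≅-trans (≅-sym (simplify a)) (≅-trans φ (simplify b)))
  (≅-dec +↔⊎ +↔⊎ (twoLayerEdge? F (proj₁ a)) (twoLayerEdge? F (proj₁ b)))
  where
  F = firstLayer n
  simplify : ∀ a → netGraph a ≅ twoLayerGraph F (proj₁ a)
  simplify a = networkGraph≅twoLayerGraph F (proj₁ a)

-- Enumerating valid layers

witnesses : ∀ {A : Set} {P : A → Set} → (∀ a → Dec (P a)) → List A → List (Σ A P)
witnesses P? [] = []
witnesses P? (a ∷ as) with P? a
... | yes p = (a , p) ∷ witnesses P? as
... | no _ = witnesses P? as

-- The listed proof is the one returned by `P?`, not the given one, so `Q` is required for every
-- proof.
witnesses⁺ : ∀ {A : Set} {P : A → Set} (P? : ∀ a → Dec (P a)) {Q : Σ A P → Set} {a as} →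
             P a → (∀ p → Q (a , p)) → a ∈ as → Any Q (witnesses P? as)
witnesses⁺ P? {a = a} p q (here refl) with P? a
... | yes p' = here (q p')
... | no ¬p = ⊥-elim (¬p p)
witnesses⁺ P? {as = b ∷ _} p q (there a∈) with P? b
... | yes _ = there (witnesses⁺ P? p q a∈)
... | no _ = witnesses⁺ P? p q a∈

comparators : ∀ n → List (Comparator n)
comparators n = map (λ ((i , j) , i<j) → comp i j i<j)
  (witnesses (λ (i , j) → i Finₚ.<? j) (cartesianProduct (allFin n) (allFin n)))

∈-comparators : (c : Comparator n) → c ∈ comparators n
∈-comparators (comp i j i<j) = Anyₚ.map⁺ (witnesses⁺ (λ (i , j) → i Finₚ.<? j) i<j (λ _ → comparator-≡ refl refl)
  (∈-cartesianProduct⁺ (∈-allFin i) (∈-allFin j)))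

listsUpTo : ∀ {A : Set} → List A → ℕ → List (List A)
listsUpTo xs zero = [] ∷ []
listsUpTo xs (suc k) = [] ∷ cartesianProductWith _∷_ xs (listsUpTo xs k)

∈-listsUpTo : ∀ {A : Set} {xs : List A} → (∀ x → x ∈ xs) → ∀ k ys → length ys ≤ k → ys ∈ listsUpTo xs k
∈-listsUpTo all zero [] _ = here refl
∈-listsUpTo all (suc k) [] _ = here refl
∈-listsUpTo all (suc k) (y ∷ ys) (s≤s l) = there (∈-cartesianProductWith⁺ _∷_ (all y) (∈-listsUpTo all k ys l))

valid? : (L : Layer n) → Dec (ValidLayer L)
valid? = allPairs? λ c d → ¬? (usedBy? (lo c) d) ×-dec ¬? (usedBy? (hi c) d)

valid-lo-injective : ∀ {L : Layer n} → ValidLayer L → ∀ {i j} → lo (List.lookup L i) ≡ lo (List.lookup L j) → i ≡ j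
valid-lo-injective (a ∷ v) {fz} {fz} e = refl
valid-lo-injective (a ∷ v) {fz} {fs j} e = ⊥-elim (proj₁ (All.lookup a (∈-lookup j)) (inj₁ e))
valid-lo-injective (a ∷ v) {fs i} {fz} e = ⊥-elim (proj₁ (All.lookup a (∈-lookup i)) (inj₁ (sym e)))
valid-lo-injective (a ∷ v) {fs i} {fs j} e = cong fs (valid-lo-injective v e)

-- Lower channels within a valid layer are distinct. This bounds the length of the lists that have
-- to be enumerated.
valid-length : ∀ {L : Layer n} → ValidLayer L → length L ≤ n
valid-length v = injective⇒≤ (valid-lo-injective v)

twoLayers : ∀ n → List (TwoLayer n)
twoLayers n = witnesses valid? (listsUpTo (comparators n) n)

-- Only the layer matters for the graph, so the listed network may carry a different validity proof.
twoLayers-complete : (a : TwoLayer n) → Any (λ b → netGraph a ≅ netGraph b) (twoLayers n)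
twoLayers-complete {n} a@(L , v) =
  witnesses⁺ valid? v (λ _ → ≅-refl) (∈-listsUpTo ∈-comparators n L (valid-length v))

-- Counting classes

module _ {A : Set} {R : A → A → Set} (R-refl : ∀ a → R a a) (R-sym : ∀ {a b} → R a b → R b a)
         (R-trans : ∀ {a b c} → R a b → R b c → R a c) (R? : ∀ a b → Dec (R a b)) where

  private
    -- Greedy choice: an element is kept only if it is unrelated to all representatives kept so far.
    representatives : ∀ xs → Σ (List A) λ ys → AllPairs (λ x y → ¬ R x y) ys × (∀ {a} → Any (R a) xs → Any (R a) ys)
    representatives [] = [] , [] , id
    representatives (x ∷ xs) with representatives xs
    ... | ys , distinct , cover with any? (R? x) ys
    ...   | yes r = ys , distinct , λ { (here p) → Any.map (R-trans p) r ; (there q) → cover q }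
    ...   | no ¬r = x ∷ ys , ¬Any⇒All¬ ys ¬r ∷ distinct , λ { (here p) → here p ; (there q) → there (cover q) }

    distinct-index : ∀ {ys} → AllPairs (λ x y → ¬ R x y) ys → ∀ i j → R (List.lookup ys i) (List.lookup ys j) → i ≡ j
    distinct-index (a ∷ d) fz fz r = refl
    distinct-index (a ∷ d) fz (fs j) r = ⊥-elim (All.lookup a (∈-lookup j) r)
    distinct-index (a ∷ d) (fs i) fz r = ⊥-elim (All.lookup a (∈-lookup i) (R-sym r))
    distinct-index (a ∷ d) (fs i) (fs j) r = cong fs (distinct-index d i j r)

  finitelyManyClasses : ∀ xs → (∀ a → Any (R a) xs) → ∃ (NumClasses A R)
  finitelyManyClasses xs complete with ys , distinct , cover ← representatives xs =
    length ys , index , (λ i → List.lookup ys i , distinct-index distinct _ _ (R-sym (related (List.lookup ys i)))) ,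
    λ a b → mk⇔
      (λ e → R-trans (related a) (subst (λ i → R (List.lookup ys i) b) (sym e) (R-sym (related b))))
      (λ r → distinct-index distinct _ _ (R-trans (R-sym (related a)) (R-trans r (related b))))
    where
    index : A → Fin (length ys)
    index a = Any.index (cover (complete a))
    related : ∀ a → R a (List.lookup ys (index a))
    related a = Anyₚ.lookup-index (cover (complete a))

-- Elements of `B` are classified through `g`; `f` only supplies an element for each class and need
-- not respect the relations.
NumClasses-transfer : ∀ {A B : Set} {R : A → A → Set} {S : B → B → Set} (f : A → B) (g : B → A) →
  (∀ a → R (g (f a)) a) → (∀ b b' → R (g b) (g b') ⇔ S b b') → NumClasses A R k → NumClasses B S k
NumClasses-transfer f g section same (class , onto , fibres) = class ∘ g ,
  (λ i → let a , e = onto i in f a , trans (Equivalence.from (fibres _ _) (section a)) e) ,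
  λ b b' → same b b' ⇔-∘ fibres (g b) (g b')

addPair-NumClasses : ∀ {A B : Set} (𝒢 : A → Graph) (ℋ : B → Graph) →
  (∀ a → ∃ λ b → addPair (𝒢 a) ≅ ℋ b) → (∀ b → ∃ λ a → addPair (𝒢 a) ≅ ℋ b) →
  NumClasses A (λ a a' → 𝒢 a ≅ 𝒢 a') k → NumClasses B (λ b b' → ℋ b ≅ ℋ b') k
addPair-NumClasses 𝒢 ℋ add remove = NumClasses-transfer (proj₁ ∘ add) (proj₁ ∘ remove)
  (λ a → addPair-cancel (≅-trans (proj₂ (remove _)) (≅-sym (proj₂ (add a)))))
  λ b b' → mk⇔
    (λ φ → ≅-trans (≅-sym (proj₂ (remove b))) (≅-trans (addPair-cong φ) (proj₂ (remove b'))))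
    (λ φ → addPair-cancel (≅-trans (proj₂ (remove b)) (≅-trans φ (≅-sym (proj₂ (remove b'))))))

theorem3 : ∀ (n : ℕ) → 2 ≤ n →
    Σ ℕ λ r →
    NumClasses (TwoLayer (n ∸ 2)) (λ a b → net a ≈ net b) r ×
    NumClasses (RedundantTwoLayer n) (λ a b → net (proj₁ a) ≈ net (proj₁ b)) r
theorem3 1 (s≤s ())
theorem3 (suc (suc m)) _ = proj₁ classes ,
  -- Transfer along `id` only exchanges the record `_≅_` for the pair type `_≈_`.
  NumClasses-transfer id id (λ _ → ≅-refl) (λ _ _ → ≅⇔≈) (proj₂ classes) ,
  NumClasses-transfer id id (λ _ → ≅-refl) (λ _ _ → ≅⇔≈)
    (addPair-NumClasses netGraph (netGraph ∘ proj₁) (λ a → extend a , extend-graph a) reduce (proj₂ classes))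
  where
  classes : ∃ (NumClasses (TwoLayer m) (λ a b → netGraph a ≅ netGraph b))
  classes = finitelyManyClasses (λ _ → ≅-refl) ≅-sym ≅-trans netGraph-≅? (twoLayers m) twoLayers-complete

  ≅⇔≈ : ∀ {n} {C C' : Network n} → (networkGraph C ≅ networkGraph C') ⇔ (C ≈ C')
  ≅⇔≈ = mk⇔ (λ (iso f e) → f , e) (λ (f , e) → iso f e)
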